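{- Let $n\ge 1$ and let $T$ be any binary tree with $n+1$ leaves. Let $B(T)$ be the Young diagram obtained from $T$ by the bookshelf construction, let $D(T)$ be the Dyck path from $(0,0)$ to $(n,n)$ associated with $T$, and let $Y(D(T))$ be the Young diagram formed by the unit squares of the $n\times n$ square lying above the path $D(T)$. Then $B(T)=Y(D(T))$. That is, the triangle of maps (binary trees $\to$ Dyck paths $\to$ Young diagrams, and the bookshelf map binary trees $\to$ Young diagrams) commutes.
   Context: A binary tree is a finite planar rooted tree in which every internal node has exactly two children (a left child and a right child). A Young diagram is a weakly decreasing sequence $\lambda_1\ge\lambda_2\ge\cdots\ge 0$ of integers with finitely many nonzero terms, where $\lambda_i$ is the number of boxes in row $i$; the empty diagram is allowed. A Dyck path from $(0,0)$ to $(n,n)$ is a lattice path of unit up and right steps staying weakly above the diagonal $x=y$. Tree to Dyck path. Label every internal node of $T$ by "left" and every leaf by "down". Read the nodes of $T$ in the preorder that visits a node first, then its right subtree, then its left subtree, omitting the last node read (the leftmost leaf). Starting at $(n,n)$, draw a unit step to the left for every label "left" and a unit step down for every label "down", in the order read. This traces, backwards from $(n,n)$ to $(0,0)$, the Dyck path $D(T)$. Dyck path to Young diagram. $Y(D)$ consists of the unit squares of $[0,n]\times[0,n]$ above (to the upper left of) the path $D$; row $1$ is the top row, and rows are left-justified. Coordinates on the tree. Draw $T$ so that all leaves lie on the bottom level. A node $v$ of $T$ (internal or leaf) has coordinates $(m,k)$, where $m$ is the number of leaves of $T$ strictly to the right of all leaves of the subtree rooted at $v$, and $k$ is the number of leaves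 of $T$ strictly to the left of all leaves of that subtree. Thus the root is at $(0,0)$ and leaves are at $(m,n-m)$, $0\le m\le n$. Edges to right children are descending (they keep the first coordinate constant). Shelves. A maximal descending segment of $T$ with constant first coordinate $m$ runs from a point $(m,k)$ to the leaf $(m,n-m)$. The one with $m=0$ (starting at the root) is called the ceiling. Those of positive length with $m\ge1$ are called shelves. Bookshelf construction. Let the cell $(i,c)$ (row $i\ge1$, column $c\ge1$) be the unit square with corners $(i-1,c-1),(i-1,c),(i,c-1),(i,c)$. For each shelf from $(m,k)$ to $(m,n-m)$, fill in all cells $(i,c)$ with $1\le i\le m$ and $k+1\le c\le n-m$. Take the union of these sets of cells over all shelves, and push the cells of each row to the left so as to eliminate gaps. The result is $B(T)$: its $i$-th row length is the number of filled cells in row $i$. -}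

module Defs where

open import Data.List.Base
  using (List; []; _∷_; [_]; _++_; map; filter; length; upTo; foldl; reverse; drop)
open import Data.List.Properties
  using (filter-none; foldl-++; map-++; reverse-++; ++-assoc; unfold-reverse)
open import Data.List.Relation.Binary.Sublist.Propositional using (⊆-refl)
open import Data.List.Relation.Binary.Sublist.Propositional.Properties
  using (filter⁺; length-mono-≤)
import Data.List.Relation.Unary.All as All
open import Data.List.Relation.Unary.All using (All; []; _∷_)
import Data.List.Relation.Unary.Any as Any
open import Data.List.Relation.Unary.Any using (Any)
open import Data.Nat
  using (ℕ; zero; suc; _+_; _∸_; _≤_; _<_; _≤?_; _<?_; z≤n; s≤s)
open import Data.Nat.Properties
open import Data.Product using (Σ; ∃; _×_; _,_; proj₁; proj₂)
open import Data.Tree.Binary using (Tree; leaf; node; #leaves)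
open import Data.Unit using (⊤; tt)
open import Relation.Binary.PropositionalEquality
  using (_≡_; refl; sym; trans; cong; cong₂; subst; subst₂; module ≡-Reasoning)
open import Relation.Nullary using (¬_; Dec; yes; no; ¬?)
open import Relation.Nullary.Decidable using (_×-dec_; map′)
open import Relation.Unary using (Pred; Decidable)

------------------------------------------------------------------------
-- Counting

module _ {a} {A : Set a} where

  count : ∀ {p} {P : Pred A p} → Decidable P → List A → ℕ
  count P? xs = length (filter P? xs)

  count-mono : ∀ {p q} {P : Pred A p} {Q : Pred A q}
               (P? : Decidable P) (Q? : Decidable Q) →
               (∀ {x} → P x → Q x) → ∀ xs → count P? xs ≤ count Q? xs
  count-mono P? Q? P⇒Q xs =
    length-mono-≤ (filter⁺ P? Q? (λ { refl → P⇒Q }) (⊆-refl {x = xs}))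

  count-none : ∀ {p} {P : Pred A p} (P? : Decidable P) →
               (∀ x → ¬ P x) → ∀ xs → count P? xs ≡ 0
  count-none P? ¬P xs =
    cong length (filter-none P? {xs = xs} (All.tabulate (λ {x} _ → ¬P x)))

------------------------------------------------------------------------
-- Young diagrams

-- Rows are indexed from 0: row i is λᵢ₊₁.
record YoungDiagram : Set where
  field
    row        : ℕ → ℕ
    decreasing : ∀ i → row (suc i) ≤ row i
    finite     : ∃ λ N → ∀ i → N ≤ i → row i ≡ 0

open YoungDiagram public

infix 4 _≈_

_≈_ : YoungDiagram → YoungDiagram → Set
λ₁ ≈ λ₂ = ∀ i → row λ₁ i ≡ row λ₂ i

------------------------------------------------------------------------
-- Binary trees and their nodes

Shape : Set
Shape = Tree ⊤ ⊤

-- Indexed by the number of internal nodes.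
BinaryTree : ℕ → Set
BinaryTree n = Σ Shape λ t → #leaves t ≡ suc n

-- Internal nodes and leaves.
data Node : Shape → Set where
  root : ∀ {t} → Node t
  inˡ  : ∀ {l r} → Node l → Node (node l tt r)
  inʳ  : ∀ {l r} → Node r → Node (node l tt r)

leaves : (t : Shape) → List (Node t)
leaves (leaf tt)     = [ root ]
leaves (node l tt r) = map inˡ (leaves l) ++ map inʳ (leaves r)

-- v ≺ w: all leaves of the subtree at v are strictly to the left of all
-- leaves of the subtree at w.
data _≺_ : ∀ {t} → Node t → Node t → Set where
  split : ∀ {l r} {v : Node l} {w : Node r} → inˡ v ≺ inʳ w
  inˡ   : ∀ {l r} {v w : Node l} → v ≺ w → inˡ {l} {r} v ≺ inˡ w
  inʳ   : ∀ {l r} {v w : Node r} → v ≺ w → inʳ {l} {r} v ≺ inʳ w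

_≺?_ : ∀ {t} (v w : Node t) → Dec (v ≺ w)
root  ≺? _     = no λ ()
inˡ v ≺? root  = no λ ()
inˡ v ≺? inˡ w = map′ inˡ (λ { (inˡ p) → p }) (v ≺? w)
inˡ v ≺? inʳ w = yes split
inʳ v ≺? root  = no λ ()
inʳ v ≺? inˡ w = no λ ()
inʳ v ≺? inʳ w = map′ inʳ (λ { (inʳ p) → p }) (v ≺? w)

-- The coordinates (m , k) of a node.
mCoord kCoord : ∀ {t} → Node t → ℕ
mCoord {t} v = count (λ ℓ → v ≺? ℓ) (leaves t)
kCoord {t} v = count (λ ℓ → ℓ ≺? v) (leaves t)

data IsRightChild : ∀ {t} → Node t → Set where
  here : ∀ {l r} → IsRightChild (inʳ {l} {r} root)
  inˡ  : ∀ {l r} {v : Node l} → IsRightChild v → IsRightChild (inˡ {l} {r} v)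
  inʳ  : ∀ {l r} {v : Node r} → IsRightChild v → IsRightChild (inʳ {l} {r} v)

isRightChild? : ∀ {t} (v : Node t) → Dec (IsRightChild v)
isRightChild? root            = no λ ()
isRightChild? (inˡ v)         = map′ inˡ (λ { (inˡ p) → p }) (isRightChild? v)
isRightChild? (inʳ root)      = yes here
isRightChild? (inʳ (inˡ v))   = map′ inʳ (λ { (inʳ p) → p }) (isRightChild? (inˡ v))
isRightChild? (inʳ (inʳ v))   = map′ inʳ (λ { (inʳ p) → p }) (isRightChild? (inʳ v))

anyNode? : ∀ {p} (t : Shape) {P : Pred (Node t) p} → Decidable P → Dec (∃ P)
anyNode? t P? with P? root
... | yes p = yes (root , p)
anyNode? (leaf tt) P? | no ¬p = no λ { (root , p) → ¬p p }
anyNode? (node l tt r) P? | no ¬p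
  with anyNode? l (λ v → P? (inˡ v)) | anyNode? r (λ v → P? (inʳ v))
... | yes (v , p) | _           = yes (inˡ v , p)
... | no _        | yes (v , p) = yes (inʳ v , p)
... | no ¬l       | no ¬r       = no λ
  { (root  , p) → ¬p p
  ; (inˡ v , p) → ¬l (v , p)
  ; (inʳ v , p) → ¬r (v , p)
  }

------------------------------------------------------------------------
-- The bookshelf construction

-- Descending edges lead to right children, so a maximal descending
-- segment starts at a node v which is not a right child.  If v has
-- coordinates (m , k), the segment ends at the leaf (m , n ∸ m), and it
-- has positive length when k < n ∸ m.
IsShelfFrom : ∀ {t} → ℕ → Node t → Set
IsShelfFrom n v = ¬ IsRightChild v × 1 ≤ mCoord v × kCoord v < n ∸ mCoord v

-- Cell (i , c), both counted from 1, is filled in by the segment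
-- starting at v.
FilledFrom : ∀ {t} → ℕ → Node t → ℕ → ℕ → Set
FilledFrom n v i c =
  (1 ≤ i × i ≤ mCoord v) × (kCoord v + 1 ≤ c × c ≤ n ∸ mCoord v)

Filled : ∀ {n} → BinaryTree n → ℕ → ℕ → Set
Filled {n} (t , _) i c =
  Σ (Node t) λ v → IsShelfFrom n v × FilledFrom n v i c

filled? : ∀ {n} (T : BinaryTree n) i c → Dec (Filled T i c)
filled? {n} (t , _) i c = anyNode? t λ v →
  (¬? (isRightChild? v) ×-dec (1 ≤? mCoord v) ×-dec (kCoord v <? n ∸ mCoord v))
  ×-dec
  (((1 ≤? i) ×-dec (i ≤? mCoord v)) ×-dec
   ((kCoord v + 1 ≤? c) ×-dec (c ≤? n ∸ mCoord v)))

-- Every filled cell has its column among 1 , … , n.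
bookshelfRow : ∀ {n} → BinaryTree n → ℕ → ℕ
bookshelfRow {n} T i = count (λ c → filled? T (suc i) c) (map suc (upTo n))

B : ∀ {n} → BinaryTree n → YoungDiagram
B {n} T = record
  { row        = bookshelfRow T
  ; decreasing = λ i → count-mono (λ c → filled? T (suc (suc i)) c)
                   (λ c → filled? T (suc i) c)
                   (λ { (v , s , (_ , i≤m) , cs) →
                        v , s , (s≤s z≤n , ≤-trans (n≤1+n _) i≤m) , cs })
                   (map suc (upTo n))
  ; finite     = n , λ i n≤i → count-none (λ c → filled? T (suc i) c)
                   (λ { c (v , (_ , _ , k<n∸m) , (_ , i<m) , _) →
                        n≮0 (subst (kCoord v <_)
                          (m≤n⇒m∸n≡0 (≤-trans n≤i (<⇒≤ i<m))) k<n∸m) })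
                   (map suc (upTo n))
  }

------------------------------------------------------------------------
-- Dyck paths

Point : Set
Point = ℕ × ℕ

data Step : Set where
  up right : Step

move : Point → Step → Point
move (x , y) up    = x , suc y
move (x , y) right = suc x , y

vertices : Point → List Step → List Point
vertices p []       = p ∷ []
vertices p (s ∷ ss) = p ∷ vertices (move p s) ss

WeaklyAbove : Point → Set
WeaklyAbove (x , y) = x ≤ y

record DyckPath (n : ℕ) : Set where
  field
    steps : List Step
    ends  : foldl move (0 , 0) steps ≡ (n , n)
    above : All WeaklyAbove (vertices (0 , 0) steps)

open DyckPath public

------------------------------------------------------------------------
-- From Dyck paths to Young diagrams

-- The unit square [a , a+1] × [b , b+1] is to the upper left of the path
-- when its lower right corner (a+1 , b) is weakly to the upper left of
-- some vertex of the path.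
SquareAbove : ∀ {n} → DyckPath n → ℕ → ℕ → Set
SquareAbove D a b =
  Any (λ { (x , y) → suc a ≤ x × y ≤ b }) (vertices (0 , 0) (steps D))

squareAbove? : ∀ {n} (D : DyckPath n) a b → Dec (SquareAbove D a b)
squareAbove? D a b =
  Any.any? (λ { (x , y) → (suc a ≤? x) ×-dec (y ≤? b) })
    (vertices (0 , 0) (steps D))

-- Row i, counted from 0 at the top, of the n × n square occupies the
-- heights from n ∸ suc i to n ∸ i.
InRow : ∀ {n} → DyckPath n → ℕ → ℕ → Set
InRow {n} D i a = i < n × SquareAbove D a (n ∸ suc i)

inRow? : ∀ {n} (D : DyckPath n) i a → Dec (InRow D i a)
inRow? {n} D i a = (i <? n) ×-dec squareAbove? D a (n ∸ suc i)

Y : ∀ {n} → DyckPath n → YoungDiagram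
Y {n} D = record
  { row        = λ i → count (inRow? D i) (upTo n)
  ; decreasing = λ i → count-mono (inRow? D (suc i)) (inRow? D i)
                   (λ { (i<n , sq) → <⇒≤ i<n ,
                        Any.map (λ { (a<x , y≤b) →
                          a<x , ≤-trans y≤b (∸-monoʳ-≤ n (n≤1+n (suc i))) }) sq })
                   (upTo n)
  ; finite     = n , λ i n≤i → count-none (inRow? D i)
                   (λ { a (i<n , _) → <⇒≱ i<n n≤i }) (upTo n)
  }

------------------------------------------------------------------------
-- From trees to Dyck paths

data Label : Set where
  left down : Label

preorder : Shape → List Label
preorder (leaf tt)     = down ∷ []
preorder (node l tt r) = left ∷ preorder r ++ preorder l

-- A step to the left (down) is a step to the right (up) when the path
-- is traversed in the opposite direction.
opposite : Label → Step
opposite left = right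
opposite down = up

-- The labels trace the path from (n , n) back to (0 , 0), so the path
-- itself is read off the reversed list; its head is the last node read,
-- which is omitted.
dyckSteps : Shape → List Step
dyckSteps t = map opposite (drop 1 (reverse (preorder t)))

private

  All-vertices-++ : ∀ {e} xs {ys} →
    All WeaklyAbove (vertices e xs) →
    All WeaklyAbove (vertices (foldl move e xs) ys) →
    All WeaklyAbove (vertices e (xs ++ ys))
  All-vertices-++ []       _        qs = qs
  All-vertices-++ (x ∷ xs) (p ∷ ps) qs = p ∷ All-vertices-++ xs ps qs

  record Walk (e : Point) (w : List Step) (e′ : Point) : Set where
    constructor walk
    field
      reaches : foldl move e w ≡ e′
      stays   : All WeaklyAbove (vertices e w)

  infixr 5 _▷_

  _▷_ : ∀ {e e′ e″ xs ys} → Walk e xs e′ → Walk e′ ys e″ → Walk e (xs ++ ys) e″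
  _▷_ {e} {xs = xs} {ys} (walk refl ps) (walk q qs) =
    walk (trans (foldl-++ move e xs ys) q) (All-vertices-++ xs ps qs)

  rest : Shape → List Step
  rest (leaf tt)     = []
  rest (node l tt r) = rest l ++ up ∷ rest r ++ right ∷ []

  rest-correct : ∀ t → map opposite (reverse (preorder t)) ≡ up ∷ rest t
  rest-correct (leaf tt)     = refl
  rest-correct (node l tt r) = begin
    map opposite (reverse (left ∷ R ++ L))
      ≡⟨ cong (map opposite) (unfold-reverse left (R ++ L)) ⟩
    map opposite (reverse (R ++ L) ++ [ left ])
      ≡⟨ map-++ opposite (reverse (R ++ L)) [ left ] ⟩
    map opposite (reverse (R ++ L)) ++ [ right ]
      ≡⟨ cong (λ xs → map opposite xs ++ [ right ]) (reverse-++ R L) ⟩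
    map opposite (reverse L ++ reverse R) ++ [ right ]
      ≡⟨ cong (_++ [ right ]) (map-++ opposite (reverse L) (reverse R)) ⟩
    (map opposite (reverse L) ++ map opposite (reverse R)) ++ [ right ]
      ≡⟨ cong₂ (λ xs ys → (xs ++ ys) ++ [ right ])
               (rest-correct l) (rest-correct r) ⟩
    up ∷ (rest l ++ up ∷ rest r) ++ [ right ]
      ≡⟨ cong (up ∷_) (++-assoc (rest l) (up ∷ rest r) [ right ]) ⟩
    up ∷ rest (node l tt r) ∎
    where
    open ≡-Reasoning
    L = preorder l
    R = preorder r

  dyckSteps-rest : ∀ t → dyckSteps t ≡ rest t
  dyckSteps-rest t = trans (map-drop (reverse (preorder t)))
                           (cong (drop 1) (rest-correct t))
    where
    map-drop : ∀ xs → map opposite (drop 1 xs) ≡ drop 1 (map opposite xs)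
    map-drop []       = refl
    map-drop (x ∷ xs) = refl

  #internal : Shape → ℕ
  #internal (leaf tt)     = 0
  #internal (node l tt r) = suc (#internal r + #internal l)

  #leaves-internal : ∀ t → #leaves t ≡ suc (#internal t)
  #leaves-internal (leaf tt)     = refl
  #leaves-internal (node l tt r) = begin
    #leaves l + #leaves r
      ≡⟨ cong₂ _+_ (#leaves-internal l) (#leaves-internal r) ⟩
    suc (#internal l) + suc (#internal r)
      ≡⟨ +-comm (suc (#internal l)) (suc (#internal r)) ⟩
    suc (#internal r) + suc (#internal l)
      ≡⟨ cong suc (+-suc (#internal r) (#internal l)) ⟩
    suc (#internal (node l tt r)) ∎
    where open ≡-Reasoning

  rest-walk : ∀ t {x y} → x ≤ y →
              Walk (x , y) (rest t) (#internal t + x , #internal t + y)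
  rest-walk (leaf tt)             x≤y = walk refl (x≤y ∷ [])
  rest-walk (node l tt r) {x} {y} x≤y =
    rest-walk l x≤y ▷ up-step ▷ rest-walk r lx≤1+ly ▷ right-step
    where
    nl = #internal l
    nr = #internal r

    lx≤ly : nl + x ≤ nl + y
    lx≤ly = +-monoʳ-≤ nl x≤y

    lx≤1+ly : nl + x ≤ suc (nl + y)
    lx≤1+ly = m≤n⇒m≤1+n lx≤ly

    up-step : Walk (nl + x , nl + y) [ up ] (nl + x , suc (nl + y))
    up-step = walk refl (lx≤ly ∷ lx≤1+ly ∷ [])

    final : suc (nr + nl + x) ≤ suc (nr + nl + y)
    final = s≤s (+-monoʳ-≤ (nr + nl) x≤y)

    right-step : Walk (nr + (nl + x) , nr + suc (nl + y)) [ right ]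
                      (suc (nr + nl + x) , suc (nr + nl + y))
    right-step
      rewrite +-suc nr (nl + y) | sym (+-assoc nr nl x) | sym (+-assoc nr nl y)
      = walk refl (m≤n⇒m≤1+n (s≤s⁻¹ final) ∷ final ∷ [])
      where open import Data.Nat using (s≤s⁻¹)

  dyckSteps-walk : ∀ {n} ((t , _) : BinaryTree n) →
                   Walk (0 , 0) (dyckSteps t) (n , n)
  dyckSteps-walk {n} (t , #t) =
    subst₂ (Walk (0 , 0)) (sym (dyckSteps-rest t)) (cong₂ _,_ eq eq)
      (rest-walk t z≤n)
    where
    eq : #internal t + 0 ≡ n
    eq = trans (+-identityʳ _)
               (suc-injective (trans (sym (#leaves-internal t)) #t))

D : ∀ {n} → BinaryTree n → DyckPath n
D T = record
  { steps = dyckSteps (proj₁ T)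
  ; ends  = Walk.reaches (dyckSteps-walk T)
  ; above = Walk.stays (dyckSteps-walk T)
  }

{-# OPTIONS --safe #-}
-- Column c of the bookshelf picture is the gap between the leaves c − 1 and c
-- (numbered from 0), that is, the internal node at which the paths to these two leaves part.
-- Since subtrees span nested or disjoint blocks of leaves, cell (i , c) is
-- filled exactly when that node has first coordinate at least i, so row i of
-- B T counts the internal nodes with at least i leaves to their right.  In
-- D T every internal node contributes one right step, whose height is the index
-- (from the left) of the rightmost leaf below the node; hence row i of Y (D T),
-- the number of right steps of height at most n − i, is the same count.
module Submission where

open import Data.Bool.Base using (true; false; if_then_else_)
open import Data.List.Base
  using (List; []; _∷_; [_]; _++_; map; filter; length; applyUpTo; reverse; drop)
open import Data.List.Properties
  using (filter-++; filter-all; length-++; length-map; map-upTo; map-++; drop-map;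
         reverse-++; unfold-reverse; ++-assoc)
import Data.List.Relation.Unary.All as All
open import Data.List.Relation.Unary.Any using (Any; here; there)
open import Data.Nat
  using (ℕ; zero; suc; _+_; _∸_; _≤_; _<_; _≤?_; _<?_; z≤n; s≤s; s≤s⁻¹)
open import Data.Nat.Properties
open import Data.Product using (∃; _×_; _,_; proj₁; proj₂)
open import Data.Sum.Base using (inj₁; inj₂)
open import Data.Tree.Binary using (leaf; node; #leaves; #nodes)
open import Data.Unit using (tt)
open import Defs
open import Function using (_∘_; id; _⇔_; mk⇔; Equivalence)
open import Relation.Binary.PropositionalEquality
  using (_≡_; refl; sym; trans; cong; cong₂; subst; module ≡-Reasoning)
open import Relation.Nullary using (¬_; Dec; yes; no; does; contradiction)
open import Relation.Nullary.Decidable using (_×-dec_; does-⇔; dec-true; dec-false)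
open import Relation.Unary using (Pred; Decidable)

-- Counting

indicator : ∀ {a} {A : Set a} → Dec A → ℕ
indicator A? = if does A? then 1 else 0

indicator-cong : ∀ {a b} {A : Set a} {B : Set b} (A? : Dec A) (B? : Dec B) →
                 A ⇔ B → indicator A? ≡ indicator B?
indicator-cong A? B? A⇔B = cong (if_then 1 else 0) (does-⇔ A⇔B A? B?)

indicator-true : ∀ {a} {A : Set a} (A? : Dec A) → A → indicator A? ≡ 1
indicator-true A? a = cong (if_then 1 else 0) (dec-true A? a)

indicator-false : ∀ {a} {A : Set a} (A? : Dec A) → ¬ A → indicator A? ≡ 0
indicator-false A? ¬a = cong (if_then 1 else 0) (dec-false A? ¬a)

module _ {a p} {A : Set a} {P : Pred A p} (P? : Decidable P) where

  count-∷ : ∀ x xs → count P? (x ∷ xs) ≡ indicator (P? x) + count P? xs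
  count-∷ x xs with does (P? x)
  ... | true  = refl
  ... | false = refl

  count-++ : ∀ xs ys → count P? (xs ++ ys) ≡ count P? xs + count P? ys
  count-++ xs ys = trans (cong length (filter-++ P? xs ys)) (length-++ (filter P? xs))

  count-all : (∀ x → P x) → ∀ xs → count P? xs ≡ length xs
  count-all all xs = cong length (filter-all P? {xs = xs} (All.tabulate (λ {x} _ → all x)))

  count-map : ∀ {b} {B : Set b} (f : B → A) xs →
              count P? (map f xs) ≡ count (P? ∘ f) xs
  count-map f []       = refl
  count-map f (x ∷ xs) with does (P? (f x))
  ... | true  = cong suc (count-map f xs)
  ... | false = count-map f xs

  count-cong : ∀ {q} {Q : Pred A q} (Q? : Decidable Q) → (∀ {x} → P x ⇔ Q x) →
               ∀ xs → count P? xs ≡ count Q? xs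
  count-cong Q? P⇔Q xs = ≤-antisym
    (count-mono P? Q? (Equivalence.to P⇔Q) xs)
    (count-mono Q? P? (Equivalence.from P⇔Q) xs)

-- Shifting the predicate renumbers the tail of a range from 0, which is how the columns of a right
-- subtree are counted.
countBelow : ∀ {p} {P : Pred ℕ p} → Decidable P → ℕ → ℕ
countBelow P? zero    = 0
countBelow P? (suc n) = indicator (P? 0) + countBelow (P? ∘ suc) n

count-applyUpTo : ∀ {a p} {A : Set a} {P : Pred A p} (P? : Decidable P) f n →
                  count P? (applyUpTo f n) ≡ countBelow (P? ∘ f) n
count-applyUpTo P? f zero    = refl
count-applyUpTo P? f (suc n) =
  trans (count-∷ P? (f 0) _) (cong (indicator (P? (f 0)) +_) (count-applyUpTo P? (f ∘ suc) n))

countBelow-+ : ∀ {p} {P : Pred ℕ p} (P? : Decidable P) m n →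
               countBelow P? (m + n) ≡ countBelow P? m + countBelow (P? ∘ (m +_)) n
countBelow-+ P? zero    n = refl
countBelow-+ P? (suc m) n =
  trans (cong (indicator (P? 0) +_) (countBelow-+ (P? ∘ suc) m n))
        (sym (+-assoc (indicator (P? 0)) _ _))

countBelow-cong : ∀ {p q} {P : Pred ℕ p} {Q : Pred ℕ q}
                  (P? : Decidable P) (Q? : Decidable Q) n →
                  (∀ c → c < n → P c ⇔ Q c) → countBelow P? n ≡ countBelow Q? n
countBelow-cong P? Q? zero    P⇔Q = refl
countBelow-cong P? Q? (suc n) P⇔Q = cong₂ _+_
  (indicator-cong (P? 0) (Q? 0) (P⇔Q 0 (s≤s z≤n)))
  (countBelow-cong (P? ∘ suc) (Q? ∘ suc) n (λ c c<n → P⇔Q (suc c) (s≤s c<n)))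

countBelow-all : ∀ {p} {P : Pred ℕ p} (P? : Decidable P) n →
                 (∀ c → c < n → P c) → countBelow P? n ≡ n
countBelow-all P? zero    all = refl
countBelow-all P? (suc n) all = cong₂ _+_
  (indicator-true (P? 0) (all 0 (s≤s z≤n)))
  (countBelow-all (P? ∘ suc) n (λ c c<n → all (suc c) (s≤s c<n)))

-- Evaluates a row of `Y (D T)`, whose squares occupy an initial segment of the columns.
countBelow-< : ∀ {m n} → m ≤ n → countBelow (_<? m) n ≡ m
countBelow-< {n = zero}          z≤n       = refl
countBelow-< {zero}  {n = suc n} z≤n       =
  trans (countBelow-cong (λ c → suc c <? 0) (_<? 0) n (λ c _ → mk⇔ (λ ()) (λ ())))
        (countBelow-< {n = n} z≤n)
countBelow-< {suc m} {n = suc n} (s≤s m≤n) = cong suc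
  (trans (countBelow-cong (λ c → suc c <? suc m) (_<? m) n (λ c _ → mk⇔ s≤s⁻¹ s≤s))
         (countBelow-< m≤n))

-- Trees and coordinates

#leaves≡1+#nodes : ∀ (t : Shape) → #leaves t ≡ suc (#nodes t)
#leaves≡1+#nodes (leaf tt)     = refl
#leaves≡1+#nodes (node l tt r) = cong₂ _+_ (#leaves≡1+#nodes l) (#leaves≡1+#nodes r)

length-leaves : ∀ t → length (leaves t) ≡ #leaves t
length-leaves (leaf tt)     = refl
length-leaves (node l tt r) = trans (length-++ (map inˡ (leaves l))) (cong₂ _+_
  (trans (length-map inˡ (leaves l)) (length-leaves l))
  (trans (length-map inʳ (leaves r)) (length-leaves r)))

count-leaves : ∀ {p} l r {P : Pred (Node (node l tt r)) p} (P? : Decidable P) →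
               count P? (leaves (node l tt r)) ≡
               count (P? ∘ inˡ) (leaves l) + count (P? ∘ inʳ) (leaves r)
count-leaves l r P? =
  trans (count-++ P? (map inˡ (leaves l)) _)
        (cong₂ _+_ (count-map P? inˡ (leaves l)) (count-map P? inʳ (leaves r)))

mCoord-root : ∀ t → mCoord {t} root ≡ 0
mCoord-root t = count-none (root ≺?_) (λ _ ()) (leaves t)

kCoord-root : ∀ t → kCoord {t} root ≡ 0
kCoord-root t = count-none (_≺? root) (λ _ ()) (leaves t)

module _ (l r : Shape) where

  mCoord-inˡ : ∀ v → mCoord (inˡ {l} {r} v) ≡ mCoord v + #leaves r
  mCoord-inˡ v = trans (count-leaves l r (inˡ v ≺?_)) (cong₂ _+_
    (count-cong _ _ (mk⇔ (λ { (inˡ p) → p }) inˡ) (leaves l))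
    (trans (count-all _ (λ _ → split) (leaves r)) (length-leaves r)))

  mCoord-inʳ : ∀ v → mCoord (inʳ {l} {r} v) ≡ mCoord v
  mCoord-inʳ v = trans (count-leaves l r (inʳ v ≺?_)) (cong₂ _+_
    (count-none _ (λ _ ()) (leaves l))
    (count-cong _ _ (mk⇔ (λ { (inʳ p) → p }) inʳ) (leaves r)))

  kCoord-inˡ : ∀ v → kCoord (inˡ {l} {r} v) ≡ kCoord v
  kCoord-inˡ v = trans (count-leaves l r (_≺? inˡ v)) (trans (cong₂ _+_
    (count-cong _ _ (mk⇔ (λ { (inˡ p) → p }) inˡ) (leaves l))
    (count-none _ (λ _ ()) (leaves r)))
    (+-identityʳ _))

  kCoord-inʳ : ∀ v → kCoord (inʳ {l} {r} v) ≡ #leaves l + kCoord v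
  kCoord-inʳ v = trans (count-leaves l r (_≺? inʳ v)) (cong₂ _+_
    (trans (count-all _ (λ _ → split) (leaves l)) (length-leaves l))
    (count-cong _ _ (mk⇔ (λ { (inʳ p) → p }) inʳ) (leaves r)))

  inˡ-mono : ∀ {u v} → mCoord u ≡ mCoord v × kCoord u ≤ kCoord v →
             mCoord (inˡ {l} {r} u) ≡ mCoord (inˡ {l} {r} v) ×
             kCoord (inˡ {l} {r} u) ≤ kCoord (inˡ {l} {r} v)
  inˡ-mono {u} {v} (m≡ , k≤)
    rewrite mCoord-inˡ u | mCoord-inˡ v | kCoord-inˡ u | kCoord-inˡ v =
    cong (_+ #leaves r) m≡ , k≤

  inʳ-mono : ∀ {u v} → mCoord u ≡ mCoord v × kCoord u ≤ kCoord v →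
             mCoord (inʳ {l} {r} u) ≡ mCoord (inʳ {l} {r} v) ×
             kCoord (inʳ {l} {r} u) ≤ kCoord (inʳ {l} {r} v)
  inʳ-mono {u} {v} (m≡ , k≤)
    rewrite mCoord-inʳ u | mCoord-inʳ v | kCoord-inʳ u | kCoord-inʳ v =
    m≡ , +-monoʳ-≤ (#leaves l) k≤

-- Climbing right edges from `v` keeps the first coordinate and can only lower the second, and it
-- stops at a node that is not a right child.
segmentStart : ∀ t (v : Node t) → ∃ λ (u : Node t) →
               ¬ IsRightChild u × mCoord u ≡ mCoord v × kCoord u ≤ kCoord v
segmentStart _ root = root , (λ ()) , refl , ≤-refl
segmentStart (node l tt r) (inˡ v) with segmentStart l v
... | u , ¬u , below = inˡ u , (λ { (inˡ p) → ¬u p }) , inˡ-mono l r {u} {v} below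
segmentStart t@(node l tt r) (inʳ v) with segmentStart r v
-- The root of `r` is a right child in `t`, so the segment continues up to the root of `t`.
... | root , _ , m≡ , _ = root , (λ ())
  , (begin
      mCoord {t} root    ≡⟨ mCoord-root t ⟩
      0                  ≡⟨ mCoord-root r ⟨
      mCoord {r} root    ≡⟨ m≡ ⟩
      mCoord v           ≡⟨ mCoord-inʳ l r v ⟨
      mCoord (inʳ {l} v) ∎)
  , subst (_≤ kCoord (inʳ {l} v)) (sym (kCoord-root t)) z≤n
  where open ≡-Reasoning
-- With `u` not the root of `r`, the constructor `here` cannot make `inʳ u` a right child.
... | u@(inˡ _) , ¬u , below = inʳ u , (λ { (inʳ p) → ¬u p }) , inʳ-mono l r {u} {v} below
... | u@(inʳ _) , ¬u , below = inʳ u , (λ { (inʳ p) → ¬u p }) , inʳ-mono l r {u} {v} below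

-- The number of internal nodes of t with at least i leaves to their right,
-- where t is a subtree with p leaves to its right.
nodesFrom : ℕ → ℕ → Shape → ℕ
nodesFrom i p (leaf tt)     = 0
nodesFrom i p (node l tt r) =
  nodesFrom i (#leaves r + p) l + (indicator (i ≤? p) + nodesFrom i p r)

-- Every node of `t` has the `p` leaves beyond `t` to its right.
nodesFrom-all : ∀ {i p} t → i ≤ p → nodesFrom i p t ≡ #nodes t
nodesFrom-all             (leaf tt)     i≤p = refl
nodesFrom-all {i} {p} (node l tt r) i≤p = cong₂ _+_
  (nodesFrom-all l (≤-trans i≤p (m≤n+m p (#leaves r))))
  (cong₂ _+_ (indicator-true (i ≤? p) i≤p) (nodesFrom-all r i≤p))

nodesFrom≤#nodes : ∀ i p t → nodesFrom i p t ≤ #nodes t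
nodesFrom≤#nodes i p (leaf tt)     = z≤n
nodesFrom≤#nodes i p (node l tt r) = +-mono-≤ (nodesFrom≤#nodes i _ l)
  (+-mono-≤ indicator≤1 (nodesFrom≤#nodes i p r))
  where
  indicator≤1 : indicator (i ≤? p) ≤ 1
  indicator≤1 with does (i ≤? p)
  ... | true  = ≤-refl
  ... | false = z≤n

-- The bookshelf side

-- The column is c + 1, counted within t, and p is the number of leaves to the
-- right of t.  The node v need not start its segment: by segmentStart, moving
-- up to the start only enlarges the set of cells.
CoveredBy : ℕ → ℕ → (t : Shape) → ℕ → Node t → Set
CoveredBy i p t c v = i ≤ mCoord v + p × kCoord v ≤ c × c + mCoord v < #nodes t

Covered : ℕ → ℕ → (t : Shape) → ℕ → Set
Covered i p t c = ∃ (CoveredBy i p t c)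

covered? : ∀ i p t → Decidable (Covered i p t)
covered? i p t c = anyNode? t λ v →
  (i ≤? mCoord v + p) ×-dec (kCoord v ≤? c) ×-dec (c + mCoord v <? #nodes t)

-- The root has coordinates `(0 , 0)`, so its segment spans every column of `t` and reaches exactly
-- the rows up to `p`.
coveredBy-root⁺ : ∀ {i p} t {c} → i ≤ p → c < #nodes t → CoveredBy i p t c root
coveredBy-root⁺ t {c} i≤p c<n rewrite mCoord-root t | kCoord-root t | +-identityʳ c =
  i≤p , z≤n , c<n

coveredBy-root⁻ : ∀ {i p} t {c} → CoveredBy i p t c root → i ≤ p
coveredBy-root⁻ t (i≤ , _) rewrite mCoord-root t = i≤

module _ (i p : ℕ) (l r : Shape) where

  private
    L = #nodes l
    R = #nodes r

    -- The columns of `node l tt r` are the `L` gaps inside `l`, the gap `L` between the subtrees,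
    -- and the `R` gaps inside `r`. The leaves of `r` add `suc R` to both sides of the last bound.
    coveredBy-inˡ : ∀ c v → CoveredBy i p (node l tt r) c (inˡ v) ⇔
                            CoveredBy i (#leaves r + p) l c v
    coveredBy-inˡ c v
      rewrite mCoord-inˡ l r v | kCoord-inˡ l r v
            | +-assoc (mCoord v) (#leaves r) p
            | sym (+-assoc c (mCoord v) (#leaves r)) | #leaves≡1+#nodes r =
      mk⇔ (λ (i≤ , k≤ , c<) → i≤ , k≤ , +-cancelʳ-< (suc R) (c + mCoord v) L c<)
          (λ (i≤ , k≤ , c<) → i≤ , k≤ , +-monoˡ-< (suc R) c<)

    -- The `suc L` leaves of `l` lie to the left of every node of `r`.
    ¬coveredBy-inʳ : ∀ c v → c ≤ L → ¬ CoveredBy i p (node l tt r) c (inʳ v)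
    ¬coveredBy-inʳ c v c≤L (_ , k≤ , _)
      rewrite kCoord-inʳ l r v | #leaves≡1+#nodes l =
      <⇒≱ (s≤s c≤L) (≤-trans (m≤m+n (suc L) (kCoord v)) k≤)

    coveredBy-inʳ : ∀ c v → CoveredBy i p (node l tt r) (L + suc c) (inʳ v) ⇔
                            CoveredBy i p r c v
    coveredBy-inʳ c v
      rewrite mCoord-inʳ l r v | kCoord-inʳ l r v | #leaves≡1+#nodes l
            | +-suc L c | +-assoc L c (mCoord v) | +-suc L R =
      mk⇔ (λ (i≤ , k≤ , c<) → i≤ , +-cancelˡ-≤ (suc L) _ _ k≤ , +-cancelˡ-< (suc L) _ _ c<)
          (λ (i≤ , k≤ , c<) → i≤ , +-monoʳ-≤ (suc L) k≤ , +-monoʳ-< (suc L) c<)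

    ¬coveredBy-inˡ : ∀ c v → L ≤ c → ¬ CoveredBy i p (node l tt r) c (inˡ v)
    ¬coveredBy-inˡ c v L≤c cov with Equivalence.to (coveredBy-inˡ c v) cov
    ... | _ , _ , c< = <⇒≱ c< (≤-trans L≤c (m≤m+n c _))

  covered-left : ¬ i ≤ p → ∀ c → c < L →
                 Covered i p (node l tt r) c ⇔ Covered i (#leaves r + p) l c
  covered-left i≰p c c<L = mk⇔
    (λ { (root , cov)  → contradiction (coveredBy-root⁻ (node l tt r) cov) i≰p
       ; (inˡ v , cov) → v , Equivalence.to (coveredBy-inˡ c v) cov
       ; (inʳ v , cov) → contradiction cov (¬coveredBy-inʳ c v (<⇒≤ c<L)) })
    (λ (v , cov) → inˡ v , Equivalence.from (coveredBy-inˡ c v) cov)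

  -- Segments from `l` stop before the gap between the subtrees and those from `r` begin after it,
  -- so only the root can span it. The column is given by an equation because splitting the range
  -- yields `L + 0`.
  ¬covered-middle : ¬ i ≤ p → ∀ c → c ≡ L → ¬ Covered i p (node l tt r) c
  ¬covered-middle i≰p c refl (root  , cov) = i≰p (coveredBy-root⁻ (node l tt r) cov)
  ¬covered-middle i≰p c refl (inˡ v , cov) = ¬coveredBy-inˡ c v ≤-refl cov
  ¬covered-middle i≰p c refl (inʳ v , cov) = ¬coveredBy-inʳ c v ≤-refl cov

  covered-right : ¬ i ≤ p → ∀ c →
                  Covered i p (node l tt r) (L + suc c) ⇔ Covered i p r c
  covered-right i≰p c = mk⇔
    (λ { (root , cov)  → contradiction (coveredBy-root⁻ (node l tt r) cov) i≰p
       ; (inˡ v , cov) → contradiction cov (¬coveredBy-inˡ (L + suc c) v (m≤m+n L _))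
       ; (inʳ v , cov) → v , Equivalence.to (coveredBy-inʳ c v) cov })
    (λ (v , cov) → inʳ v , Equivalence.from (coveredBy-inʳ c v) cov)

-- If `i ≤ p`, the root covers all columns and every node is counted. Otherwise the root covers
-- none, and the columns left of, at and right of the middle gap match the three summands of
-- `nodesFrom`.
countBelow-covered : ∀ i p t → countBelow (covered? i p t) (#nodes t) ≡ nodesFrom i p t
countBelow-covered i p (leaf tt) = refl
countBelow-covered i p t@(node l tt r) with ≤-<-connex i p
... | inj₁ i≤p = trans
  (countBelow-all (covered? i p t) (#nodes t)
    (λ c c<n → root , coveredBy-root⁺ t i≤p c<n))
  (sym (nodesFrom-all t i≤p))
... | inj₂ p<i = trans (countBelow-+ (covered? i p t) (#nodes l) (suc (#nodes r)))
  (cong₂ _+_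
    (trans (countBelow-cong _ (covered? i (#leaves r + p) l) (#nodes l)
             (covered-left i p l r i≰p))
           (countBelow-covered i (#leaves r + p) l))
    (cong₂ _+_
      (trans (indicator-false (covered? i p t (#nodes l + 0))
               (¬covered-middle i p l r i≰p _ (+-identityʳ (#nodes l))))
             (sym (indicator-false (i ≤? p) i≰p)))
      (trans (countBelow-cong _ (covered? i p r) (#nodes r)
               (λ c _ → covered-right i p l r i≰p c))
             (countBelow-covered i p r))))
  where
  i≰p : ¬ i ≤ p
  i≰p = <⇒≱ p<i

-- `Covered` omits the conditions on a shelf. They return as follows: `segmentStart` supplies the
-- start, the row index `suc i` excludes the ceiling, and `k ≤ c < n ∸ m` gives positive length.
filled⇔covered : ∀ {n} (T : BinaryTree n) → #nodes (proj₁ T) ≡ n → ∀ i c →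
                 Filled T (suc i) (suc c) ⇔ Covered (suc i) 0 (proj₁ T) c
filled⇔covered {n} T@(t , _) refl i c = mk⇔ to from
  where
  to : Filled T (suc i) (suc c) → Covered (suc i) 0 t c
  to (v , (_ , _ , k<n∸m) , (_ , i<m) , k<c , c≤n∸m) =
    v , subst (suc i ≤_) (sym (+-identityʳ _)) i<m
      , s≤s⁻¹ (subst (_≤ suc c) (+-comm _ 1) k<c)
      , m≤o∸n⇒m+n≤o (suc c) (<⇒≤ m<n) c≤n∸m
    where
    -- `m ≤ n` is what allows the truncated `n ∸ m` to be moved across the inequality; the positive
    -- length supplies it.
    m<n : mCoord v < n
    m<n = m∸n≢0⇒n<m λ eq → n≮0 (subst (kCoord v <_) eq k<n∸m)

  from : Covered (suc i) 0 t c → Filled T (suc i) (suc c)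
  from (v , i<m+0 , k≤c , c+m<n) with segmentStart t v
  ... | u , ¬u , m≡ , k≤ =
    u , (¬u , ≤-trans (s≤s z≤n) i<m , ≤-trans (s≤s k′≤c) c<n∸m)
      , (s≤s z≤n , i<m)
      , subst (_≤ suc c) (+-comm 1 _) (s≤s k′≤c) , c<n∸m
    where
    k′≤c : kCoord u ≤ c
    k′≤c = ≤-trans k≤ k≤c

    i<m : suc i ≤ mCoord u
    i<m = subst (suc i ≤_) (trans (+-identityʳ _) (sym m≡)) i<m+0

    c<n∸m : suc c ≤ n ∸ mCoord u
    c<n∸m = m+n≤o⇒m≤o∸n (suc c) (subst (λ m → suc c + m ≤ n) (sym m≡) c+m<n)

row-B : ∀ {n} (T : BinaryTree n) → #nodes (proj₁ T) ≡ n → ∀ i →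
        row (B T) i ≡ nodesFrom (suc i) 0 (proj₁ T)
row-B {n} T@(t , _) #t i = begin
  row (B T) i
    ≡⟨ cong (count (filled? T (suc i))) (map-upTo suc n) ⟩
  count (filled? T (suc i)) (applyUpTo suc n)
    ≡⟨ count-applyUpTo (filled? T (suc i)) suc n ⟩
  countBelow (filled? T (suc i) ∘ suc) n
    ≡⟨ countBelow-cong _ (covered? (suc i) 0 t) n (λ c _ → filled⇔covered T #t i c) ⟩
  countBelow (covered? (suc i) 0 t) n
    ≡⟨ cong (countBelow (covered? (suc i) 0 t)) #t ⟨
  countBelow (covered? (suc i) 0 t) (#nodes t)
    ≡⟨ countBelow-covered (suc i) 0 t ⟩
  nodesFrom (suc i) 0 t ∎
  where open ≡-Reasoning

-- The Dyck path side

rightsUpTo : ℕ → ℕ → List Step → ℕ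
rightsUpTo b y []           = 0
rightsUpTo b y (up ∷ ss)    = rightsUpTo b (suc y) ss
rightsUpTo b y (right ∷ ss) = indicator (y ≤? b) + rightsUpTo b y ss

height : ℕ → List Step → ℕ
height y []           = y
height y (up ∷ ss)    = height (suc y) ss
height y (right ∷ ss) = height y ss

height-++ : ∀ y xs ys → height y (xs ++ ys) ≡ height (height y xs) ys
height-++ y []           ys = refl
height-++ y (up ∷ xs)    ys = height-++ (suc y) xs ys
height-++ y (right ∷ xs) ys = height-++ y xs ys

rightsUpTo-++ : ∀ b y xs ys → rightsUpTo b y (xs ++ ys) ≡
                rightsUpTo b y xs + rightsUpTo b (height y xs) ys
rightsUpTo-++ b y []           ys = refl
rightsUpTo-++ b y (up ∷ xs)    ys = rightsUpTo-++ b (suc y) xs ys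
rightsUpTo-++ b y (right ∷ xs) ys =
  trans (cong (indicator (y ≤? b) +_) (rightsUpTo-++ b y xs ys))
        (sym (+-assoc (indicator (y ≤? b)) _ _))

-- Accounts for the leading `up` of `treeSteps`, which raises the whole path by one.
rightsUpTo-suc : ∀ b y ss → rightsUpTo (suc b) (suc y) ss ≡ rightsUpTo b y ss
rightsUpTo-suc b y []           = refl
rightsUpTo-suc b y (up ∷ ss)    = rightsUpTo-suc b (suc y) ss
rightsUpTo-suc b y (right ∷ ss) = cong₂ _+_
  (indicator-cong (suc y ≤? suc b) (y ≤? b) (mk⇔ s≤s⁻¹ s≤s)) (rightsUpTo-suc b y ss)

rightsUpTo-above : ∀ {b y} ss → b < y → rightsUpTo b y ss ≡ 0
rightsUpTo-above         []           b<y = refl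
rightsUpTo-above         (up ∷ ss)    b<y = rightsUpTo-above ss (m≤n⇒m≤1+n b<y)
rightsUpTo-above {b} {y} (right ∷ ss) b<y =
  cong₂ _+_ (indicator-false (y ≤? b) (<⇒≱ b<y)) (rightsUpTo-above ss b<y)

-- Squares above a path and right steps

UpperLeftOf : ℕ → ℕ → Point → Set
UpperLeftOf a b (x , y) = suc a ≤ x × y ≤ b

-- Heights never decrease along the path.
startsBelow : ∀ {a b x y} ss → Any (UpperLeftOf a b) (vertices (x , y) ss) → y ≤ b
startsBelow []           (here (_ , y≤b)) = y≤b
startsBelow (s ∷ ss)     (here (_ , y≤b)) = y≤b
startsBelow (up ∷ ss)    (there p)        = <⇒≤ (startsBelow ss p)
startsBelow (right ∷ ss) (there p)        = startsBelow ss p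

-- A vertex of height at most `b` is preceded only by right steps of height at most `b`, so its
-- horizontal coordinate is at most `x + rightsUpTo b y ss`.
upperLeft⇒< : ∀ {a b x y} ss → Any (UpperLeftOf a b) (vertices (x , y) ss) →
              a < x + rightsUpTo b y ss
upperLeft⇒< []       (here (a<x , _)) = ≤-trans a<x (m≤m+n _ _)
upperLeft⇒< (s ∷ ss) (here (a<x , _)) = ≤-trans a<x (m≤m+n _ _)
upperLeft⇒< (up ∷ ss)    (there p) = upperLeft⇒< ss p
upperLeft⇒< {a} {b} {x} {y} (right ∷ ss) (there p)
  rewrite indicator-true (y ≤? b) (startsBelow ss p) | +-suc x (rightsUpTo b y ss) =
  upperLeft⇒< ss p

-- The witness is the last vertex of height at most `b`, whose horizontal coordinate is exactly
-- `x + rightsUpTo b y ss`.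
<⇒upperLeft : ∀ {a b x y} ss → y ≤ b → a < x + rightsUpTo b y ss →
              Any (UpperLeftOf a b) (vertices (x , y) ss)
<⇒upperLeft {x = x} []        y≤b a< = here (subst (_ <_) (+-identityʳ x) a< , y≤b)
<⇒upperLeft {a} {b} {x} {y} (up ∷ ss) y≤b a< with suc y ≤? b
... | yes y<b = there (<⇒upperLeft ss y<b a<)
-- The next step rises above `b`, so no later right step counts and the current vertex is the last
-- one.
... | no y≮b  = here
  ( subst (a <_) (trans (cong (x +_) (rightsUpTo-above ss (≰⇒> y≮b))) (+-identityʳ x)) a<
  , y≤b )
<⇒upperLeft {a} {b} {x} {y} (right ∷ ss) y≤b a<
  rewrite indicator-true (y ≤? b) y≤b | +-suc x (rightsUpTo b y ss) =
  there (<⇒upperLeft ss y≤b a<)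

-- Keeps the last node read, which `dyckSteps` omits, so that every subtree contributes a contiguous
-- block of the same form.
treeSteps : Shape → List Step
treeSteps t = map opposite (reverse (preorder t))

treeSteps-node : ∀ l r → treeSteps (node l tt r) ≡
                 treeSteps l ++ treeSteps r ++ [ right ]
treeSteps-node l r = begin
  map opposite (reverse (left ∷ preorder r ++ preorder l))
    ≡⟨ cong (map opposite) (unfold-reverse left (preorder r ++ preorder l)) ⟩
  map opposite (reverse (preorder r ++ preorder l) ++ [ left ])
    ≡⟨ cong (λ ls → map opposite (ls ++ [ left ])) (reverse-++ (preorder r) (preorder l)) ⟩
  map opposite ((reverse (preorder l) ++ reverse (preorder r)) ++ [ left ])
    ≡⟨ cong (map opposite) (++-assoc (reverse (preorder l)) (reverse (preorder r)) [ left ]) ⟩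
  map opposite (reverse (preorder l) ++ reverse (preorder r) ++ [ left ])
    ≡⟨ map-++ opposite (reverse (preorder l)) _ ⟩
  treeSteps l ++ map opposite (reverse (preorder r) ++ [ left ])
    ≡⟨ cong (treeSteps l ++_) (map-++ opposite (reverse (preorder r)) [ left ]) ⟩
  treeSteps l ++ treeSteps r ++ [ right ] ∎
  where open ≡-Reasoning

-- The last node read is the leftmost leaf, so the omitted step is an `up`.
treeSteps-dyckSteps : ∀ t → treeSteps t ≡ up ∷ dyckSteps t
treeSteps-dyckSteps t with treeSteps-up t
  where
  treeSteps-up : ∀ t → ∃ λ ss → treeSteps t ≡ up ∷ ss
  treeSteps-up (leaf tt)     = [] , refl
  treeSteps-up (node l tt r) with treeSteps-up l
  ... | ss , eq = ss ++ treeSteps r ++ [ right ]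
                , trans (treeSteps-node l r) (cong (_++ treeSteps r ++ [ right ]) eq)
... | ss , eq = trans eq (cong (up ∷_)
  (trans (sym (cong (drop 1) eq)) (drop-map 1 (reverse (preorder t)))))

height-treeSteps : ∀ t y → height y (treeSteps t) ≡ y + #leaves t
height-treeSteps (leaf tt)     y = +-comm 1 y
height-treeSteps (node l tt r) y = begin
  height y (treeSteps (node l tt r))
    ≡⟨ cong (height y) (treeSteps-node l r) ⟩
  height y (treeSteps l ++ treeSteps r ++ [ right ])
    ≡⟨ height-++ y (treeSteps l) _ ⟩
  height (height y (treeSteps l)) (treeSteps r ++ [ right ])
    ≡⟨ height-++ _ (treeSteps r) [ right ] ⟩
  height (height y (treeSteps l)) (treeSteps r)
    ≡⟨ height-treeSteps r _ ⟩
  height y (treeSteps l) + #leaves r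
    ≡⟨ cong (_+ #leaves r) (height-treeSteps l y) ⟩
  y + #leaves l + #leaves r
    ≡⟨ +-assoc y (#leaves l) (#leaves r) ⟩
  y + #leaves (node l tt r) ∎
  where open ≡-Reasoning

-- The hypothesis says b = N − i, where N = y + #leaves t + p is the total
-- number of leaves, so that height at most b means at least i leaves to the right.
rightsUpTo-treeSteps : ∀ {b i} t {y p} → y + #leaves t + p ≡ b + i →
                       rightsUpTo b y (treeSteps t) ≡ nodesFrom i p t
rightsUpTo-treeSteps         (leaf tt)             eq = refl
rightsUpTo-treeSteps {b} {i} (node l tt r) {y} {p} eq = begin
  rightsUpTo b y (treeSteps (node l tt r))
    ≡⟨ cong (rightsUpTo b y) (treeSteps-node l r) ⟩
  rightsUpTo b y (treeSteps l ++ treeSteps r ++ [ right ])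
    ≡⟨ rightsUpTo-++ b y (treeSteps l) _ ⟩
  rightsUpTo b y (treeSteps l) + rightsUpTo b (height y (treeSteps l)) (treeSteps r ++ [ right ])
    ≡⟨ cong₂ _+_ (rightsUpTo-treeSteps l eqˡ)
        (cong (λ h → rightsUpTo b h (treeSteps r ++ [ right ])) (height-treeSteps l y)) ⟩
  nodesFrom i (#leaves r + p) l + rightsUpTo b y′ (treeSteps r ++ [ right ])
    ≡⟨ cong (nodesFrom i (#leaves r + p) l +_) (rightsUpTo-++ b y′ (treeSteps r) [ right ]) ⟩
  nodesFrom i (#leaves r + p) l +
    (rightsUpTo b y′ (treeSteps r) + (indicator (height y′ (treeSteps r) ≤? b) + 0))
    ≡⟨ cong (nodesFrom i (#leaves r + p) l +_)
        (cong₂ _+_ (rightsUpTo-treeSteps r eqʳ) (trans (+-identityʳ _) last-step)) ⟩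
  nodesFrom i (#leaves r + p) l + (nodesFrom i p r + indicator (i ≤? p))
    ≡⟨ cong (nodesFrom i (#leaves r + p) l +_) (+-comm (nodesFrom i p r) _) ⟩
  nodesFrom i p (node l tt r) ∎
  where
  open ≡-Reasoning
  y′ = y + #leaves l

  eqʳ : y′ + #leaves r + p ≡ b + i
  eqʳ = trans (cong (_+ p) (+-assoc y (#leaves l) (#leaves r))) eq

  eqˡ : y + #leaves l + (#leaves r + p) ≡ b + i
  eqˡ = trans (sym (+-assoc y′ (#leaves r) p)) eqʳ

  balance : ∀ {h} → h + p ≡ b + i → h ≤ b ⇔ i ≤ p
  balance {h} h+p≡b+i = mk⇔
    (λ h≤b → +-cancelˡ-≤ b i p (subst (_≤ b + p) h+p≡b+i (+-monoˡ-≤ p h≤b)))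
    (λ i≤p → +-cancelʳ-≤ p h b (subst (_≤ b + p) (sym h+p≡b+i) (+-monoʳ-≤ b i≤p)))

  -- The right step of the root follows all steps of both subtrees, when exactly `p` leaves are
  -- still to come.
  last-step : indicator (height y′ (treeSteps r) ≤? b) ≡ indicator (i ≤? p)
  last-step = indicator-cong (height y′ (treeSteps r) ≤? b) (i ≤? p)
    (balance (trans (cong (_+ p) (height-treeSteps r y′)) eqʳ))

row-Y : ∀ {n} (T : BinaryTree n) → #nodes (proj₁ T) ≡ n → ∀ {i} → i < n →
        row (Y (D T)) i ≡ nodesFrom (suc i) 0 (proj₁ T)
row-Y {n} T@(t , #t) #nodes-t {i} i<n = begin
  row (Y (D T)) i
    ≡⟨ count-applyUpTo (inRow? (D T) i) id n ⟩
  countBelow (inRow? (D T) i) n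
    ≡⟨ countBelow-cong _ (_<? nodesFrom (suc i) 0 t) n inRow⇔< ⟩
  countBelow (_<? nodesFrom (suc i) 0 t) n
    ≡⟨ countBelow-< (subst (nodesFrom (suc i) 0 t ≤_) #nodes-t (nodesFrom≤#nodes (suc i) 0 t)) ⟩
  nodesFrom (suc i) 0 t ∎
  where
  open ≡-Reasoning
  b = n ∸ suc i

  rights : rightsUpTo b 0 (dyckSteps t) ≡ nodesFrom (suc i) 0 t
  rights = begin
    rightsUpTo b 0 (dyckSteps t)
      ≡⟨ rightsUpTo-suc b 0 (dyckSteps t) ⟨
    rightsUpTo (suc b) 0 (up ∷ dyckSteps t)
      ≡⟨ cong (rightsUpTo (suc b) 0) (treeSteps-dyckSteps t) ⟨
    rightsUpTo (suc b) 0 (treeSteps t)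
      -- The leading `up` turns the bound `b` into `suc b`, and `suc b + suc i` is `suc n`, the
      -- number of leaves.
      ≡⟨ rightsUpTo-treeSteps t (trans (+-identityʳ _) (trans #t (cong suc (sym (m∸n+n≡m i<n))))) ⟩
    nodesFrom (suc i) 0 t ∎

  inRow⇔< : ∀ a → a < n → InRow (D T) i a ⇔ a < nodesFrom (suc i) 0 t
  inRow⇔< a _ = mk⇔
    (λ (_ , above) → subst (a <_) rights (upperLeft⇒< (dyckSteps t) above))
    (λ a< → i<n , <⇒upperLeft (dyckSteps t) z≤n (subst (a <_) (sym rights) a<))

mainTheorem2 : ∀ (n : ℕ) → 1 ≤ n → (T : BinaryTree n) → B T ≈ Y (D T)
mainTheorem2 n _ T@(t , #t) i with <-≤-connex i n
... | inj₁ i<n = trans (row-B T #nodes-t i) (sym (row-Y T #nodes-t i<n))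
  where
  #nodes-t : #nodes t ≡ n
  #nodes-t = suc-injective (trans (sym (#leaves≡1+#nodes t)) #t)
-- Below the square both rows are empty.
... | inj₂ n≤i = trans (proj₂ (finite (B T)) i n≤i)
                      (sym (proj₂ (finite (Y (D T))) i n≤i))
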